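{- For every fixed integer $k \ge 1$, \[ \sum_{n \ge 0} w(n,k) q^n = \frac{q^{k+4}}{(1-q)^2(1-q^2)^{k+1}}, \] where $w(n,k)$ is the number of compositions of $n$ with all parts in $\{1,2\}$ having exactly $k$ water cells.
   Context: A composition of $n \ge 0$ is a finite sequence $(c_1,\dots,c_t)$ of positive integers with $c_1+\cdots+c_t=n$; the empty composition is the unique composition of $0$. Let $C_{12}(n)$ be the set of compositions of $n$ all of whose parts lie in $\{1,2\}$. The number of water cells of a composition $(c_1,\dots,c_t)$ is $\sum_{i=1}^{t} \max\bigl(0, \min(\max_{j \le i} c_j, \max_{j \ge i} c_j) - c_i\bigr)$ (the number of unit squares that would hold water poured over its bargraph, in which column $i$ has height $c_i$). For $n,k \ge 0$, $W(n,k)$ is the set of compositions in $C_{12}(n)$ with exactly $k$ water cells and $w(n,k)=|W(n,k)|$. -}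

module Defs where

open import Data.Empty using (⊥)
open import Data.Fin.Base as Fin using (Fin; toℕ)
open import Data.Integer.Base as ℤ using (ℤ; 0ℤ; 1ℤ)
import Data.Integer.Properties as ℤ
open import Data.List.Base
  using (List; []; _∷_; _++_; map; foldr; take; drop; length; lookup; allFin; filter)
open import Data.List.Membership.Propositional using (_∈_)
open import Data.List.Membership.Propositional.Properties
  using (∈-map⁺; ∈-map⁻; ∈-++⁺ˡ; ∈-++⁺ʳ; ∈-++⁻; ∈-filter⁺; ∈-filter⁻)
open import Data.List.Properties using (∷-injectiveʳ)
open import Data.List.Relation.Unary.All using (All; []; _∷_)
open import Data.List.Relation.Unary.AllPairs using ([]; _∷_)
open import Data.List.Relation.Unary.Any using (here)
open import Data.List.Relation.Unary.Unique.Propositional using (Unique)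
import Data.List.Relation.Unary.Unique.Propositional.Properties as Unique
open import Data.Nat.Base using (ℕ; zero; suc; _+_; _∸_; _⊔_; _⊓_; _<_; s≤s; z≤n)
open import Data.Nat.ListAction using (sum)
open import Data.Nat.Induction using (<-rec)
open import Data.Nat.Properties using (_≟_; suc-injective; m∸n≤m)
open import Data.Product.Base using (_×_; _,_)
open import Data.Sum.Base using (_⊎_; inj₁; inj₂)
open import Data.Vec.Base as Vec using (Vec; []; _∷_)
open import Function.Bundles using (_⇔_; mk⇔)
open import Relation.Binary.PropositionalEquality
import Algebra.Properties.Monoid.Sum

open Algebra.Properties.Monoid.Sum ℤ.+-0-monoid
  using (sum-syntax; sum⁺-syntax; sum-cong-≗)

------------------------------------------------------------------------
-- Cardinalities of finite subsets

record Enumeration {A : Set} (P : A → Set) : Set where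
  field
    elements : List A
    unique   : Unique elements
    complete : ∀ {x} → x ∈ elements ⇔ P x

open Enumeration public

-- Does not depend on the enumeration chosen, since any two of them are
-- permutations of each other.
card : {A : Set} {P : A → Set} → Enumeration P → ℕ
card e = length (elements e)

------------------------------------------------------------------------
-- Compositions and water cells

IsComposition : ℕ → List ℕ → Set
IsComposition n c = All (0 <_) c × sum c ≡ n

C₁₂ : ℕ → List ℕ → Set
C₁₂ n c = IsComposition n c × All (λ p → p ≡ 1 ⊎ p ≡ 2) c

maximum : List ℕ → ℕ
maximum = foldr _⊔_ 0

-- The positions of c are Fin (length c), counted from 0, so the entries at
-- positions ≤ i are take (1 + i) c and those at positions ≥ i are drop i c.
-- Truncated subtraction is max(0 , _ - _).
water : (c : List ℕ) → Fin (length c) → ℕ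
water c i =
  (maximum (take (suc (toℕ i)) c) ⊓ maximum (drop (toℕ i) c)) ∸ lookup c i

waterCells : List ℕ → ℕ
waterCells c = sum (map (water c) (allFin (length c)))

W : ℕ → ℕ → List ℕ → Set
W n k c = C₁₂ n c × waterCells c ≡ k

compositions₁₂ : ℕ → List (List ℕ)
compositions₁₂ 0             = [] ∷ []
compositions₁₂ 1             = (1 ∷ []) ∷ []
compositions₁₂ (suc (suc n)) =
  map (1 ∷_) (compositions₁₂ (suc n)) ++ map (2 ∷_) (compositions₁₂ n)

private
  cons₁ : ∀ {n c} → C₁₂ n c → C₁₂ (suc n) (1 ∷ c)
  cons₁ ((ps , s) , qs) = (s≤s z≤n ∷ ps , cong suc s) , inj₁ refl ∷ qs

  cons₂ : ∀ {n c} → C₁₂ n c → C₁₂ (suc (suc n)) (2 ∷ c)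
  cons₂ ((ps , s) , qs) = (s≤s z≤n ∷ ps , cong (2 +_) s) , inj₂ refl ∷ qs

  sound : ∀ n {c} → c ∈ compositions₁₂ n → C₁₂ n c
  sound 0             (here refl) = ([] , refl) , []
  sound 1             (here refl) = cons₁ (([] , refl) , [])
  sound (suc (suc n)) m with ∈-++⁻ (map (1 ∷_) (compositions₁₂ (suc n))) m
  ... | inj₁ m₁ with ∈-map⁻ (1 ∷_) m₁
  ...   | c , c∈ , refl = cons₁ (sound (suc n) c∈)
  sound (suc (suc n)) m | inj₂ m₂ with ∈-map⁻ (2 ∷_) m₂
  ...   | c , c∈ , refl = cons₂ (sound n c∈)

  exhaustive : ∀ n {c} → C₁₂ n c → c ∈ compositions₁₂ n
  exhaustive 0 {[]} _ = here refl
  exhaustive 0 {_ ∷ _} ((_ , ()) , inj₁ refl ∷ _)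
  exhaustive 0 {_ ∷ _} ((_ , ()) , inj₂ refl ∷ _)
  exhaustive 1 {_ ∷ c} ((_ ∷ ps , s) , inj₁ refl ∷ qs)
    with exhaustive 0 ((ps , suc-injective s) , qs)
  ... | here refl = here refl
  exhaustive 1 {_ ∷ _} ((_ , ()) , inj₂ refl ∷ _)
  exhaustive (suc (suc n)) {_ ∷ c} ((_ ∷ ps , s) , inj₁ refl ∷ qs) =
    ∈-++⁺ˡ (∈-map⁺ (1 ∷_) (exhaustive (suc n) ((ps , suc-injective s) , qs)))
  exhaustive (suc (suc n)) {_ ∷ c} ((_ ∷ ps , s) , inj₂ refl ∷ qs) =
    ∈-++⁺ʳ (map (1 ∷_) (compositions₁₂ (suc n)))
      (∈-map⁺ (2 ∷_) (exhaustive n ((ps , suc-injective (suc-injective s)) , qs)))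

  distinct : ∀ n → Unique (compositions₁₂ n)
  distinct 0             = [] ∷ []
  distinct 1             = [] ∷ []
  distinct (suc (suc n)) = Unique.++⁺
    (Unique.map⁺ ∷-injectiveʳ (distinct (suc n)))
    (Unique.map⁺ ∷-injectiveʳ (distinct n))
    λ (m₁ , m₂) → disjoint m₁ m₂
    where
    disjoint : ∀ {c} → c ∈ map (1 ∷_) (compositions₁₂ (suc n)) →
               c ∈ map (2 ∷_) (compositions₁₂ n) → ⊥
    disjoint m₁ m₂ with ∈-map⁻ (1 ∷_) m₁ | ∈-map⁻ (2 ∷_) m₂
    ... | _ , _ , refl | _ , _ , ()

W-enumeration : ∀ n k → Enumeration (W n k)
W-enumeration n k = record
  { elements = filter P? (compositions₁₂ n)
  ; unique   = Unique.filter⁺ P? (distinct n)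
  ; complete = mk⇔
      (λ m → let (c∈ , eq) = ∈-filter⁻ P? {xs = compositions₁₂ n} m in sound n c∈ , eq)
      (λ (c₁₂ , eq) → ∈-filter⁺ P? (exhaustive n c₁₂) eq)
  }
  where
  P? = λ c → waterCells c ≟ k

w : ℕ → ℕ → ℕ
w n k = card (W-enumeration n k)

------------------------------------------------------------------------
-- Formal power series over ℤ, as coefficient sequences

PowerSeries : Set
PowerSeries = ℕ → ℤ

infix  4 _≈_
infixl 6 _-ˢ_
infixl 7 _*ˢ_ _/ˢ_
infixr 8 _^ˢ_

_≈_ : PowerSeries → PowerSeries → Set
a ≈ b = ∀ n → a n ≡ b n

1ˢ : PowerSeries
1ˢ zero    = 1ℤ
1ˢ (suc _) = 0ℤ

q : PowerSeries
q zero    = 0ℤ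
q (suc n) = 1ˢ n

_-ˢ_ : PowerSeries → PowerSeries → PowerSeries
(a -ˢ b) n = a n ℤ.- b n

_*ˢ_ : PowerSeries → PowerSeries → PowerSeries
(a *ˢ b) n = ∑[ i ≤ n ] (a (toℕ i) ℤ.* b (n ∸ toℕ i))

_^ˢ_ : PowerSeries → ℕ → PowerSeries
a ^ˢ zero  = 1ˢ
a ^ˢ suc n = a *ˢ a ^ˢ n

-- The quotient x = a / b by a series b with constant term 1, obtained by
-- solving b x = a for the coefficients:
--   x_n = a_n - (b_1 x_{n-1} + ... + b_n x_0).
-- quotientStep takes x_{n-1} , ... , x_0 to x_n, and quotientCoeffs a b n is
-- the vector of x_{n-1} , ... , x_0.  The constant term of b is not inspected;
-- if it is not 1 the result is meaningless.
quotientStep : PowerSeries → PowerSeries → ∀ n → Vec ℤ n → ℤ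
quotientStep a b n xs = a n ℤ.- ∑[ i < n ] (b (suc (toℕ i)) ℤ.* Vec.lookup xs i)

quotientCoeffs : PowerSeries → PowerSeries → ∀ n → Vec ℤ n
quotientCoeffs a b zero    = []
quotientCoeffs a b (suc n) = quotientStep a b n xs ∷ xs
  where xs = quotientCoeffs a b n

_/ˢ_ : PowerSeries → PowerSeries → PowerSeries
(a /ˢ b) n = quotientStep a b n (quotientCoeffs a b n)

private
  lookup-quotientCoeffs : ∀ a b n (i : Fin n) →
    Vec.lookup (quotientCoeffs a b n) i ≡ (a /ˢ b) (n ∸ suc (toℕ i))
  lookup-quotientCoeffs a b (suc n) Fin.zero    = refl
  lookup-quotientCoeffs a b (suc n) (Fin.suc i) = lookup-quotientCoeffs a b n i

  tailSum : PowerSeries → PowerSeries → ℕ → ℤ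
  tailSum b x n = ∑[ i < n ] (b (suc (toℕ i)) ℤ.* x (n ∸ suc (toℕ i)))

  /ˢ-unfold : ∀ a b n → (a /ˢ b) n ≡ a n ℤ.- tailSum b (a /ˢ b) n
  /ˢ-unfold a b n = cong (λ t → a n ℤ.- t)
    (sum-cong-≗ {n} λ i → cong (b (suc (toℕ i)) ℤ.*_) (lookup-quotientCoeffs a b n i))

  *ˢ-unfold : ∀ b x n → b 0 ≡ 1ℤ → (b *ˢ x) n ≡ x n ℤ.+ tailSum b x n
  *ˢ-unfold b x n b₀ = cong (ℤ._+ tailSum b x n)
    (trans (cong (ℤ._* x n) b₀) (ℤ.*-identityˡ (x n)))

/ˢ-solves : ∀ a b → b 0 ≡ 1ℤ → b *ˢ (a /ˢ b) ≈ a
/ˢ-solves a b b₀ n = begin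
  (b *ˢ x) n                       ≡⟨ *ˢ-unfold b x n b₀ ⟩
  x n ℤ.+ t                        ≡⟨ cong (ℤ._+ t) (/ˢ-unfold a b n) ⟩
  (a n ℤ.- t) ℤ.+ t                ≡⟨ ℤ.+-assoc (a n) (ℤ.- t) t ⟩
  a n ℤ.+ (ℤ.- t ℤ.+ t)            ≡⟨ cong (λ s → a n ℤ.+ s) (ℤ.+-inverseˡ t) ⟩
  a n ℤ.+ 0ℤ                       ≡⟨ ℤ.+-identityʳ (a n) ⟩
  a n                              ∎
  where
  open ≡-Reasoning
  x = a /ˢ b
  t = tailSum b x n

/ˢ-unique : ∀ a b x → b 0 ≡ 1ℤ → b *ˢ x ≈ a → x ≈ a /ˢ b
/ˢ-unique a b x b₀ bx≈a = <-rec (λ n → x n ≡ (a /ˢ b) n) λ n ih →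
  let open ≡-Reasoning
      t = tailSum b x n
      t≡ = sum-cong-≗ {n} λ i → cong (b (suc (toℕ i)) ℤ.*_) (ih (smaller i))
  in begin
  x n                              ≡⟨ ℤ.+-identityʳ (x n) ⟨
  x n ℤ.+ 0ℤ                       ≡⟨ cong (λ s → x n ℤ.+ s) (ℤ.+-inverseʳ t) ⟨
  x n ℤ.+ (t ℤ.- t)                ≡⟨ ℤ.+-assoc (x n) t (ℤ.- t) ⟨
  (x n ℤ.+ t) ℤ.- t                ≡⟨ cong (ℤ._- t) (*ˢ-unfold b x n b₀) ⟨
  (b *ˢ x) n ℤ.- t                 ≡⟨ cong₂ ℤ._-_ (bx≈a n) t≡ ⟩
  a n ℤ.- tailSum b (a /ˢ b) n     ≡⟨ /ˢ-unfold a b n ⟨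
  (a /ˢ b) n                       ∎
  where
  smaller : ∀ {n} (i : Fin n) → n ∸ suc (toℕ i) < n
  smaller {suc n} i = s≤s (m∸n≤m n (toℕ i))

*ˢ-constant : ∀ a b → a 0 ≡ 1ℤ → b 0 ≡ 1ℤ → (a *ˢ b) 0 ≡ 1ℤ
*ˢ-constant a b a₀ b₀ rewrite a₀ | b₀ = refl

^ˢ-constant : ∀ a n → a 0 ≡ 1ℤ → (a ^ˢ n) 0 ≡ 1ℤ
^ˢ-constant a zero    a₀ = refl
^ˢ-constant a (suc n) a₀ = *ˢ-constant a (a ^ˢ n) a₀ (^ˢ-constant a n a₀)

denominator-constant : ∀ k →
  ((1ˢ -ˢ q) ^ˢ 2 *ˢ (1ˢ -ˢ q ^ˢ 2) ^ˢ (k + 1)) 0 ≡ 1ℤ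
denominator-constant k = *ˢ-constant ((1ˢ -ˢ q) ^ˢ 2) ((1ˢ -ˢ q ^ˢ 2) ^ˢ (k + 1))
  refl (^ˢ-constant (1ˢ -ˢ q ^ˢ 2) (k + 1) refl)

{-# OPTIONS --safe #-}

-- A word in 1 and 2 holds water exactly over the 1s lying between two 2s.  Let A k,
-- F k and H k be the generating functions of the words c such that c, 2 ∷ c and
-- 2 ∷ 1 ∷ c, respectively, have k water cells.  For k ≥ 1, splitting off the first
-- letter of c gives
--   A k = q A k + q² F k,   F k = q H k + q² F k,   H (k + 1) = q H k + q² F k = F k,
-- while H 1 = q² F 0 and (1 - q)(1 - q²) F 0 = 1.  Hence (1 - q²) F (k + 1) = q F k,
-- (1 - q²) F 1 = q³ F 0 and (1 - q) A k = q² F k.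

module Submission where

open import Algebra.Bundles using (CommutativeRing)
open import Algebra.Consequences.Setoid using (comm∧idˡ⇒id; comm∧distrʳ⇒distr)
import Algebra.Construct.Pointwise as Pointwise
import Algebra.Properties.AbelianGroup as AbelianGroupProperties
import Algebra.Properties.CommutativeSemigroup as CommutativeSemigroupProperties
import Algebra.Properties.Ring as RingProperties
open import Algebra.Structures using (module IsAbelianGroup)
open import Data.Bool.Base using (true; false)
open import Data.Fin.Base as Fin using (Fin; toℕ)
open import Data.Integer.Base as ℤ using (ℤ; +_; 0ℤ; 1ℤ)
import Data.Integer.Properties as ℤ
open import Data.Integer.Tactic.RingSolver using (solve-∀)
open import Data.List.Base
  using (List; []; _∷_; _++_; map; take; drop; length; lookup; allFin; tabulate; filter)
open import Data.List.Properties
  using (map-cong; map-cong-local; map-∘; map-tabulate; filter-++; length-++; filter-≐; filter-none)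
open import Data.List.Relation.Unary.All as All using (All; []; _∷_; universal)
import Data.List.Relation.Unary.All.Properties as All
open import Data.Nat.Base using (ℕ; zero; suc; _+_; _∸_; _⊔_; _⊓_; _≤_; s≤s; z≤n)
open import Data.Nat.ListAction using (sum)
import Data.Nat.Properties as ℕ
open import Data.Nat.Properties
  using (_≟_; ⊔-assoc; ⊔-identityʳ; suc-injective; m≥n⇒m⊔n≡m; m≤n⇒m≤1+n; m⊓n≤m; m≤n⇒m∸n≡0)
open import Data.Product.Base using (_×_; _,_)
open import Data.Sum.Base using (_⊎_; inj₁; inj₂)
open import Function.Base using (id; _∘_)
open import Level using (0ℓ)
open import Relation.Binary.PropositionalEquality
  using (_≡_; _≢_; refl; sym; trans; cong; cong₂; module ≡-Reasoning)
import Relation.Binary.Reasoning.Setoid as SetoidReasoning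
open import Relation.Nullary using (does)
open import Relation.Unary using (_≐_)
open import Defs

-- The ring of formal power series

infixl 6 _+ˢ_
infixl 7 _·_

_+ˢ_ : PowerSeries → PowerSeries → PowerSeries
(a +ˢ b) n = a n ℤ.+ b n

_·_ : ℤ → PowerSeries → PowerSeries
(c · a) n = c ℤ.* a n

0ˢ : PowerSeries
0ˢ _ = 0ℤ

tail : PowerSeries → PowerSeries
tail a n = a (suc n)

-- The mirror image of (a *ˢ b) (suc n) = a 0 * b (suc n) + (tail a *ˢ b) n, which holds
-- by computation and is what the inductions on the degree below rest on.
*ˢ-sucʳ : ∀ a b n → (a *ˢ b) (suc n) ≡ (a *ˢ tail b) n ℤ.+ a (suc n) ℤ.* b 0
*ˢ-sucʳ a b zero    = lemma (a 0) (b 1) (a 1) (b 0)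
  where
  lemma : ∀ x y z t →
    x ℤ.* y ℤ.+ (z ℤ.* t ℤ.+ 0ℤ) ≡ x ℤ.* y ℤ.+ 0ℤ ℤ.+ z ℤ.* t
  lemma = solve-∀
*ˢ-sucʳ a b (suc n) = trans
  (cong (λ s → a 0 ℤ.* b (suc (suc n)) ℤ.+ s) (*ˢ-sucʳ (tail a) b n))
  (sym (ℤ.+-assoc (a 0 ℤ.* b (suc (suc n))) ((tail a *ˢ tail b) n) _))

*ˢ-cong : ∀ {a a′ b b′} → a ≈ a′ → b ≈ b′ → a *ˢ b ≈ a′ *ˢ b′
*ˢ-cong a≈ b≈ zero    = cong₂ (λ x y → x ℤ.* y ℤ.+ 0ℤ) (a≈ 0) (b≈ 0)
*ˢ-cong a≈ b≈ (suc n) = cong₂ ℤ._+_ (cong₂ ℤ._*_ (a≈ 0) (b≈ (suc n)))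
  (*ˢ-cong (λ m → a≈ (suc m)) b≈ n)

*ˢ-comm : ∀ a b → a *ˢ b ≈ b *ˢ a
*ˢ-comm a b zero    = cong (ℤ._+ 0ℤ) (ℤ.*-comm (a 0) (b 0))
*ˢ-comm a b (suc n) = begin
  a 0 ℤ.* b (suc n) ℤ.+ (tail a *ˢ b) n
    ≡⟨ cong₂ ℤ._+_ (ℤ.*-comm (a 0) (b (suc n))) (*ˢ-comm (tail a) b n) ⟩
  b (suc n) ℤ.* a 0 ℤ.+ (b *ˢ tail a) n
    ≡⟨ ℤ.+-comm (b (suc n) ℤ.* a 0) ((b *ˢ tail a) n) ⟩
  (b *ˢ tail a) n ℤ.+ b (suc n) ℤ.* a 0
    ≡⟨ *ˢ-sucʳ b a n ⟨
  (b *ˢ a) (suc n) ∎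
  where open ≡-Reasoning

*ˢ-distribʳ : ∀ c a b → (a +ˢ b) *ˢ c ≈ a *ˢ c +ˢ b *ˢ c
*ˢ-distribʳ c a b zero    = lemma (a 0) (b 0) (c 0)
  where
  lemma : ∀ x y z → (x ℤ.+ y) ℤ.* z ℤ.+ 0ℤ ≡ x ℤ.* z ℤ.+ 0ℤ ℤ.+ (y ℤ.* z ℤ.+ 0ℤ)
  lemma = solve-∀
*ˢ-distribʳ c a b (suc n) = trans
  (cong (λ s → (a 0 ℤ.+ b 0) ℤ.* c (suc n) ℤ.+ s) (*ˢ-distribʳ c (tail a) (tail b) n))
  (lemma (a 0) (b 0) (c (suc n)) ((tail a *ˢ c) n) ((tail b *ˢ c) n))
  where
  lemma : ∀ x y z s t →
    (x ℤ.+ y) ℤ.* z ℤ.+ (s ℤ.+ t) ≡ x ℤ.* z ℤ.+ s ℤ.+ (y ℤ.* z ℤ.+ t)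
  lemma = solve-∀

-- `tail (a *ˢ b)` is `a 0 · tail b +ˢ tail a *ˢ b`, so the induction for `*ˢ-assoc` meets a scalar
-- multiple as a left factor.
·-*ˢ-assoc : ∀ c a b → (c · a) *ˢ b ≈ c · (a *ˢ b)
·-*ˢ-assoc c a b zero    = lemma c (a 0) (b 0)
  where
  lemma : ∀ x y z → x ℤ.* y ℤ.* z ℤ.+ 0ℤ ≡ x ℤ.* (y ℤ.* z ℤ.+ 0ℤ)
  lemma = solve-∀
·-*ˢ-assoc c a b (suc n) = trans
  (cong (λ s → c ℤ.* a 0 ℤ.* b (suc n) ℤ.+ s) (·-*ˢ-assoc c (tail a) b n))
  (lemma c (a 0) (b (suc n)) ((tail a *ˢ b) n))
  where
  lemma : ∀ x y z s → x ℤ.* y ℤ.* z ℤ.+ x ℤ.* s ≡ x ℤ.* (y ℤ.* z ℤ.+ s)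
  lemma = solve-∀

*ˢ-assoc : ∀ a b c → (a *ˢ b) *ˢ c ≈ a *ˢ (b *ˢ c)
*ˢ-assoc a b c zero    = lemma (a 0) (b 0) (c 0)
  where
  lemma : ∀ x y z → (x ℤ.* y ℤ.+ 0ℤ) ℤ.* z ℤ.+ 0ℤ ≡ x ℤ.* (y ℤ.* z ℤ.+ 0ℤ) ℤ.+ 0ℤ
  lemma = solve-∀
*ˢ-assoc a b c (suc n) = begin
  (a 0 ℤ.* b 0 ℤ.+ 0ℤ) ℤ.* c (suc n) ℤ.+ ((a 0 · tail b +ˢ tail a *ˢ b) *ˢ c) n
    ≡⟨ cong (λ s → (a 0 ℤ.* b 0 ℤ.+ 0ℤ) ℤ.* c (suc n) ℤ.+ s)
         (trans (*ˢ-distribʳ c (a 0 · tail b) (tail a *ˢ b) n)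
           (cong₂ ℤ._+_ (·-*ˢ-assoc (a 0) (tail b) c n) (*ˢ-assoc (tail a) b c n))) ⟩
  (a 0 ℤ.* b 0 ℤ.+ 0ℤ) ℤ.* c (suc n) ℤ.+
    (a 0 ℤ.* (tail b *ˢ c) n ℤ.+ (tail a *ˢ (b *ˢ c)) n)
    ≡⟨ lemma (a 0) (b 0) (c (suc n)) ((tail b *ˢ c) n) ((tail a *ˢ (b *ˢ c)) n) ⟩
  a 0 ℤ.* (b *ˢ c) (suc n) ℤ.+ (tail a *ˢ (b *ˢ c)) n ∎
  where
  open ≡-Reasoning
  lemma : ∀ x y z s t → (x ℤ.* y ℤ.+ 0ℤ) ℤ.* z ℤ.+ (x ℤ.* s ℤ.+ t)
                        ≡ x ℤ.* (y ℤ.* z ℤ.+ s) ℤ.+ t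
  lemma = solve-∀

*ˢ-zeroˡ : ∀ a → 0ˢ *ˢ a ≈ 0ˢ
*ˢ-zeroˡ a zero    = refl
*ˢ-zeroˡ a (suc n) = trans (ℤ.+-identityˡ _) (*ˢ-zeroˡ a n)

*ˢ-identityˡ : ∀ a → 1ˢ *ˢ a ≈ a
*ˢ-identityˡ a zero    = trans (ℤ.+-identityʳ (1ℤ ℤ.* a 0)) (ℤ.*-identityˡ (a 0))
*ˢ-identityˡ a (suc n) = trans
  (cong₂ ℤ._+_ (ℤ.*-identityˡ (a (suc n))) (*ˢ-zeroˡ a n)) (ℤ.+-identityʳ (a (suc n)))

q-*ˢ-suc : ∀ a n → (q *ˢ a) (suc n) ≡ a n
q-*ˢ-suc a n = trans (ℤ.+-identityˡ _) (*ˢ-identityˡ a n)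

powerSeries : CommutativeRing 0ℓ 0ℓ
powerSeries = record
  { Carrier = PowerSeries
  ; _≈_ = _≈_
  ; _+_ = _+ˢ_
  ; _*_ = _*ˢ_
  ; -_ = λ a n → ℤ.- a n
  ; 0# = 0ˢ
  ; 1# = 1ˢ
  ; isCommutativeRing = record
    { isRing = record
      { +-isAbelianGroup = +-isAbelianGroup
      ; *-cong = *ˢ-cong
      ; *-assoc = *ˢ-assoc
      ; *-identity = comm∧idˡ⇒id setoid *ˢ-comm *ˢ-identityˡ
      ; distrib = comm∧distrʳ⇒distr setoid +ˢ-cong *ˢ-comm *ˢ-distribʳ
      }
    ; *-comm = *ˢ-comm
    }
  }
  where
  +-isAbelianGroup = Pointwise.isAbelianGroup ℕ ℤ.+-0-isAbelianGroup
  open IsAbelianGroup +-isAbelianGroup using (setoid) renaming (∙-cong to +ˢ-cong)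

-- Water cells of words in 1 and 2

Is12 : List ℕ → Set
Is12 = All (λ p → p ≡ 1 ⊎ p ≡ 2)

-- The cells over c when the highest column before it has height m.
fill : ℕ → List ℕ → ℕ
fill m []      = 0
fill m (x ∷ c) = ((m ⊔ x) ⊓ (x ⊔ maximum c)) ∸ x + fill (m ⊔ x) c

-- The level `m` makes the induction go through: after the first column, associativity of `⊔` moves
-- `x` out of every prefix maximum into the level. At `m = 0` the left side is `waterCells c`.
sum-fill : ∀ m c →
  sum (map (λ i → ((m ⊔ maximum (take (suc (toℕ i)) c)) ⊓ maximum (drop (toℕ i) c))
                  ∸ lookup c i)
           (allFin (length c)))
  ≡ fill m c
sum-fill m []      = refl
sum-fill m (x ∷ c) = cong₂ _+_
  (cong (λ y → (m ⊔ y) ⊓ (x ⊔ maximum c) ∸ x) (⊔-identityʳ x))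
  (begin
    sum (map cell (tabulate Fin.suc))
      ≡⟨ cong (sum ∘ map cell) (map-tabulate id Fin.suc) ⟨
    sum (map cell (map Fin.suc (allFin (length c))))
      ≡⟨ cong sum (map-∘ (allFin (length c))) ⟨
    sum (map (cell ∘ Fin.suc) (allFin (length c)))
      ≡⟨ cong sum (map-cong
           (λ i → cong (λ y → (y ⊓ maximum (drop (toℕ i) c)) ∸ lookup c i) (sym (⊔-assoc m x _)))
           (allFin (length c))) ⟩
    _
      ≡⟨ sum-fill (m ⊔ x) c ⟩
    fill (m ⊔ x) c ∎)
  where
  open ≡-Reasoning
  cell : Fin (length (x ∷ c)) → ℕ
  cell i = ((m ⊔ maximum (take (suc (toℕ i)) (x ∷ c))) ⊓ maximum (drop (toℕ i) (x ∷ c)))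
           ∸ lookup (x ∷ c) i

bump : ℕ → ℕ
bump zero    = 0
bump (suc n) = suc (suc n)

-- The cells of 2 ∷ c and of 2 ∷ 1 ∷ c, for words c in 1 and 2.  One more pending 1
-- adds a cell to 2 ∷ 1 ∷ c only if a 2 follows, that is, only if the number of cells
-- is already positive: hence bump.
cells₂ cells₂₁ : List ℕ → ℕ

cells₂ []      = 0
cells₂ (1 ∷ c) = cells₂₁ c
cells₂ (_ ∷ c) = cells₂ c

cells₂₁ []      = 0
cells₂₁ (1 ∷ c) = bump (cells₂₁ c)
cells₂₁ (_ ∷ c) = suc (cells₂ c)

-- The state before any 2: a leading 1 has no wall on its left, and the first 2 becomes that wall.
cells : List ℕ → ℕ
cells []      = 0
cells (1 ∷ c) = cells c
cells (_ ∷ c) = cells₂ c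

-- The split is on whether `c` contains a 2. Without one, nothing to the right holds water in; with
-- one, the 1 in front of `c` carries exactly one extra cell.
cells₂₁-cases : ∀ {c} → Is12 c →
  (maximum c ≤ 1 × cells₂ c ≡ 0 × cells₂₁ c ≡ 0) ⊎
  (maximum c ≡ 2 × cells₂₁ c ≡ suc (cells₂ c))
cells₂₁-cases [] = inj₁ (z≤n , refl , refl)
cells₂₁-cases {_ ∷ c} (inj₁ refl ∷ ps) with cells₂₁-cases ps
... | inj₁ (max≤1 , _ , eq) rewrite eq | m≥n⇒m⊔n≡m max≤1 = inj₁ (s≤s z≤n , refl , refl)
... | inj₂ (max≡2 , eq)     rewrite eq | max≡2           = inj₂ (refl , refl)
cells₂₁-cases {_ ∷ c} (inj₂ refl ∷ ps) with cells₂₁-cases ps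
... | inj₁ (max≤1 , _) = inj₂ (m≥n⇒m⊔n≡m (m≤n⇒m≤1+n max≤1) , refl)
... | inj₂ (max≡2 , _) rewrite max≡2 = inj₂ (refl , refl)

-- With a 2 already on the left, a 1 carries a cell exactly when a 2 is still to come, which is the
-- alternative in `cells₂₁-cases`. A 2 is never under water, since the level is capped at 2.
fill-2 : ∀ {c} → Is12 c → fill 2 c ≡ cells₂ c
fill-2 [] = refl
fill-2 {_ ∷ c} (inj₂ refl ∷ ps)
  rewrite m≤n⇒m∸n≡0 (m⊓n≤m 2 (2 ⊔ maximum c)) = fill-2 ps
fill-2 {_ ∷ c} (inj₁ refl ∷ ps) with cells₂₁-cases ps
... | inj₁ (max≤1 , eq₂ , eq₂₁) rewrite m≥n⇒m⊔n≡m max≤1 | eq₂₁ = trans (fill-2 ps) eq₂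
... | inj₂ (max≡2 , eq₂₁)       rewrite max≡2 | eq₂₁ = cong suc (fill-2 ps)

fill-1 : ∀ {c} → Is12 c → fill 1 c ≡ cells c
fill-1 [] = refl
fill-1 {_ ∷ c} (inj₁ refl ∷ ps)
  rewrite m≤n⇒m∸n≡0 (m⊓n≤m 1 (1 ⊔ maximum c)) = fill-1 ps
fill-1 {_ ∷ c} (inj₂ refl ∷ ps)
  rewrite m≤n⇒m∸n≡0 (m⊓n≤m 2 (2 ⊔ maximum c)) = fill-2 ps

-- Raising the initial level from 0 to 1 changes nothing, as no part is 0.
waterCells-cells : ∀ {c} → Is12 c → waterCells c ≡ cells c
waterCells-cells {c} ps = trans (sum-fill 0 c) (trans (fill-0≡1 ps) (fill-1 ps))
  where
  fill-0≡1 : ∀ {c} → Is12 c → fill 0 c ≡ fill 1 c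
  fill-0≡1 []              = refl
  fill-0≡1 (inj₁ refl ∷ _) = refl
  fill-0≡1 (inj₂ refl ∷ _) = refl

compositions₁₂-12 : ∀ n → All Is12 (compositions₁₂ n)
compositions₁₂-12 0             = [] ∷ []
compositions₁₂-12 1             = (inj₁ refl ∷ []) ∷ []
compositions₁₂-12 (suc (suc n)) = All.++⁺
  (All.map⁺ (All.map (inj₁ refl ∷_) (compositions₁₂-12 (suc n))))
  (All.map⁺ (All.map (inj₂ refl ∷_) (compositions₁₂-12 n)))

-- Generating functions of statistics on words

occurrences : {A : Set} → (A → ℕ) → ℕ → List A → ℕ
occurrences f k cs = length (filter (λ c → f c ≟ k) cs)

occurrences-++ : ∀ {A : Set} (f : A → ℕ) k cs ds →
  occurrences f k (cs ++ ds) ≡ occurrences f k cs + occurrences f k ds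
occurrences-++ f k cs ds =
  trans (cong length (filter-++ _ cs ds)) (length-++ (filter _ cs))

occurrences-map : ∀ {A B : Set} (f : B → ℕ) k (g : A → B) cs →
  occurrences f k (map g cs) ≡ occurrences (f ∘ g) k cs
occurrences-map f k g []       = refl
occurrences-map f k g (c ∷ cs) with does (f (g c) ≟ k)
... | true  = cong suc (occurrences-map f k g cs)
... | false = occurrences-map f k g cs

-- The two filters test different predicates; passing to the lists of values makes the predicates
-- coincide and leaves an equality of lists.
occurrences-cong : ∀ {A : Set} {f g : A → ℕ} k {cs} → All (λ c → f c ≡ g c) cs →
  occurrences f k cs ≡ occurrences g k cs
occurrences-cong {f = f} {g} k {cs} eqs = begin
  occurrences f k cs           ≡⟨ occurrences-map id k f cs ⟨
  occurrences id k (map f cs)  ≡⟨ cong (occurrences id k) (map-cong-local eqs) ⟩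
  occurrences id k (map g cs)  ≡⟨ occurrences-map id k g cs ⟩
  occurrences g k cs           ∎
  where open ≡-Reasoning

count : (List ℕ → ℕ) → ℕ → PowerSeries
count f k n = + occurrences f k (compositions₁₂ n)

count-≐ : ∀ f k g l → (λ c → f c ≡ k) ≐ (λ c → g c ≡ l) → count f k ≈ count g l
count-≐ f k g l iff n =
  cong (λ cs → + length cs) (filter-≐ (λ c → f c ≟ k) (λ c → g c ≟ l) iff (compositions₁₂ n))

count-none : ∀ f k → (∀ c → f c ≢ k) → count f k ≈ 0ˢ
count-none f k ≢k n =
  cong (λ cs → + length cs) (filter-none (λ c → f c ≟ k) (universal ≢k (compositions₁₂ n)))

w-count : ∀ k → (λ n → + w n k) ≈ count cells k
w-count k n = cong +_ (occurrences-cong k (All.map waterCells-cells (compositions₁₂-12 n)))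

q²-*ˢ-suc² : ∀ a n → (q ^ˢ 2 *ˢ a) (suc (suc n)) ≡ a n
q²-*ˢ-suc² a n = trans (*ˢ-assoc q (q *ˢ 1ˢ) a (suc (suc n)))
  (trans (q-*ˢ-suc ((q *ˢ 1ˢ) *ˢ a) (suc n))
  (trans (*ˢ-assoc q 1ˢ a (suc n))
  (trans (q-*ˢ-suc (1ˢ *ˢ a) n) (*ˢ-identityˡ a n))))

count-[] : ∀ f k → PowerSeries
count-[] f k zero    = count f k 0
count-[] f k (suc _) = 0ℤ

-- The empty word gives the first summand. The other words split by first letter, whose size becomes
-- the shift by `q` or `q ^ˢ 2`. Degree 1 is a case of its own, since only the letter 1 fits there.
count-step : ∀ f k →
  count f k ≈ count-[] f k +ˢ (q *ˢ count (f ∘ (1 ∷_)) k +ˢ q ^ˢ 2 *ˢ count (f ∘ (2 ∷_)) k)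
count-step f k zero          = sym (ℤ.+-identityʳ _)
count-step f k (suc zero)    = begin
  + occurrences f k (map (1 ∷_) (compositions₁₂ 0))
    ≡⟨ cong +_ (occurrences-map f k (1 ∷_) (compositions₁₂ 0)) ⟩
  count (f ∘ (1 ∷_)) k 0
    ≡⟨ q-*ˢ-suc (count (f ∘ (1 ∷_)) k) 0 ⟨
  (q *ˢ count (f ∘ (1 ∷_)) k) 1
    ≡⟨ ℤ.+-identityʳ _ ⟨
  (q *ˢ count (f ∘ (1 ∷_)) k) 1 ℤ.+ 0ℤ
    ≡⟨ ℤ.+-identityˡ _ ⟨
  0ℤ ℤ.+ ((q *ˢ count (f ∘ (1 ∷_)) k) 1 ℤ.+ 0ℤ) ∎
  where open ≡-Reasoning
count-step f k (suc (suc n)) = begin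
  + occurrences f k (map (1 ∷_) cs ++ map (2 ∷_) ds)
    ≡⟨ cong +_ (occurrences-++ f k (map (1 ∷_) cs) (map (2 ∷_) ds)) ⟩
  + occurrences f k (map (1 ∷_) cs) ℤ.+ + occurrences f k (map (2 ∷_) ds)
    ≡⟨ cong₂ (λ i j → + i ℤ.+ + j) (occurrences-map f k (1 ∷_) cs) (occurrences-map f k (2 ∷_) ds) ⟩
  count (f ∘ (1 ∷_)) k (suc n) ℤ.+ count (f ∘ (2 ∷_)) k n
    ≡⟨ cong₂ ℤ._+_ (q-*ˢ-suc (count (f ∘ (1 ∷_)) k) (suc n)) (q²-*ˢ-suc² (count (f ∘ (2 ∷_)) k) n) ⟨
  (q *ˢ count (f ∘ (1 ∷_)) k) (suc (suc n)) ℤ.+ (q ^ˢ 2 *ˢ count (f ∘ (2 ∷_)) k) (suc (suc n))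
    ≡⟨ ℤ.+-identityˡ _ ⟨
  0ℤ ℤ.+ ((q *ˢ count (f ∘ (1 ∷_)) k) (suc (suc n)) ℤ.+
          (q ^ˢ 2 *ˢ count (f ∘ (2 ∷_)) k) (suc (suc n))) ∎
  where
  open ≡-Reasoning
  cs = compositions₁₂ (suc n)
  ds = compositions₁₂ n

open CommutativeRing powerSeries
  using (+-cong; +-congˡ; +-congʳ; +-assoc; +-comm; *-cong; *-identityʳ; *-assoc;
         +-identityˡ; +-identityʳ; +-abelianGroup;
         *-congˡ; *-congʳ; zeroʳ; *-commutativeSemigroup; setoid; ring)
  renaming (trans to ≈-trans)
open AbelianGroupProperties +-abelianGroup using (xyx⁻¹≈y)
open CommutativeSemigroupProperties *-commutativeSemigroup using (x∙yz≈y∙xz; xy∙z≈y∙xz)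
open RingProperties ring using ([y-z]x≈yx-zx)
open SetoidReasoning setoid

count-suc : ∀ f k → f [] ≡ 0 →
  count f (suc k) ≈ q *ˢ count (f ∘ (1 ∷_)) (suc k) +ˢ q ^ˢ 2 *ˢ count (f ∘ (2 ∷_)) (suc k)
count-suc f k f[]≡0 = ≈-trans (count-step f (suc k)) (≈-trans (+-congʳ empty) (+-identityˡ _))
  where
  empty : count-[] f (suc k) ≈ 0ˢ
  empty zero    rewrite f[]≡0 = refl
  empty (suc _) = refl

count-zero : ∀ f → f [] ≡ 0 →
  count f 0 ≈ 1ˢ +ˢ (q *ˢ count (f ∘ (1 ∷_)) 0 +ˢ q ^ˢ 2 *ˢ count (f ∘ (2 ∷_)) 0)
count-zero f f[]≡0 = ≈-trans (count-step f 0) (+-congʳ empty)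
  where
  empty : count-[] f 0 ≈ 1ˢ
  empty zero    rewrite f[]≡0 = refl
  empty (suc _) = refl

-- Used with `c` equal to `q` or `q ^ˢ 2`, the weight of a letter that returns to the same series.
solve-linear : ∀ c b x → x ≈ c *ˢ x +ˢ b → (1ˢ -ˢ c) *ˢ x ≈ b
solve-linear c b x eq = begin
  -- `-ˢ` and the subtraction derived in the ring agree by computation, so the ring lemma applies.
  (1ˢ -ˢ c) *ˢ x         ≈⟨ [y-z]x≈yx-zx x 1ˢ c ⟩
  1ˢ *ˢ x -ˢ c *ˢ x      ≈⟨ +-congʳ (≈-trans (*ˢ-identityˡ x) eq) ⟩
  c *ˢ x +ˢ b -ˢ c *ˢ x  ≈⟨ xyx⁻¹≈y (c *ˢ x) b ⟩
  b                      ∎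

-- Recurrences and closed forms for the three series

A F H : ℕ → PowerSeries
A = count cells
F = count cells₂
H = count cells₂₁

count-bump-0 : count (bump ∘ cells₂₁) 0 ≈ H 0
count-bump-0 = count-≐ (bump ∘ cells₂₁) 0 cells₂₁ 0
  ((λ {c} → to (cells₂₁ c)) , λ {c} eq → cong bump eq)
  where
  to : ∀ n → bump n ≡ 0 → n ≡ 0
  to zero _ = refl

-- Two adjacent 1s between 2s already hold two cells, so `bump` skips the value 1. This is why `H 1`
-- has no `q` term.
count-bump-1 : count (bump ∘ cells₂₁) 1 ≈ 0ˢ
count-bump-1 = count-none (bump ∘ cells₂₁) 1 (λ c → bump≢1 (cells₂₁ c))
  where
  bump≢1 : ∀ n → bump n ≢ 1
  bump≢1 zero    ()
  bump≢1 (suc _) ()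

count-bump-suc : ∀ k → count (bump ∘ cells₂₁) (suc (suc k)) ≈ H (suc k)
count-bump-suc k = count-≐ (bump ∘ cells₂₁) (suc (suc k)) cells₂₁ (suc k)
  ((λ {c} → to (cells₂₁ c)) , λ {c} eq → cong bump eq)
  where
  to : ∀ n → bump n ≡ suc (suc k) → n ≡ suc k
  to (suc n) eq = suc-injective eq

count-suc∘ : ∀ f k → count (suc ∘ f) (suc k) ≈ count f k
count-suc∘ f k = count-≐ (suc ∘ f) (suc k) f k (suc-injective , cong suc)

1-q 1-q² : PowerSeries
1-q = 1ˢ -ˢ q
1-q² = 1ˢ -ˢ q ^ˢ 2

H-0 : H 0 ≈ 1ˢ +ˢ q *ˢ H 0
H-0 = begin
  H 0
    ≈⟨ count-zero cells₂₁ refl ⟩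
  1ˢ +ˢ (q *ˢ count (bump ∘ cells₂₁) 0 +ˢ q ^ˢ 2 *ˢ count (suc ∘ cells₂) 0)
    -- After `2 ∷ 1`, a 2 closes a pit and creates a cell, so the `q ^ˢ 2` term vanishes when no
    -- cells are allowed.
    ≈⟨ +-congˡ {1ˢ} (+-cong (*-congˡ {q} count-bump-0)
         (≈-trans (*-congˡ {q ^ˢ 2} (count-none (suc ∘ cells₂) 0 λ _ ())) (zeroʳ (q ^ˢ 2)))) ⟩
  1ˢ +ˢ (q *ˢ H 0 +ˢ 0ˢ)
    ≈⟨ +-congˡ {1ˢ} (+-identityʳ (q *ˢ H 0)) ⟩
  1ˢ +ˢ q *ˢ H 0 ∎

F-0 : F 0 ≈ q ^ˢ 2 *ˢ F 0 +ˢ H 0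
F-0 = begin
  F 0                                ≈⟨ count-zero cells₂ refl ⟩
  1ˢ +ˢ (q *ˢ H 0 +ˢ q ^ˢ 2 *ˢ F 0)  ≈⟨ +-assoc 1ˢ (q *ˢ H 0) (q ^ˢ 2 *ˢ F 0) ⟨
  1ˢ +ˢ q *ˢ H 0 +ˢ q ^ˢ 2 *ˢ F 0    ≈⟨ +-congʳ {q ^ˢ 2 *ˢ F 0} H-0 ⟨
  H 0 +ˢ q ^ˢ 2 *ˢ F 0               ≈⟨ +-comm (H 0) (q ^ˢ 2 *ˢ F 0) ⟩
  q ^ˢ 2 *ˢ F 0 +ˢ H 0               ∎

H-1 : H 1 ≈ q ^ˢ 2 *ˢ F 0
H-1 = begin
  H 1
    ≈⟨ count-suc cells₂₁ 0 refl ⟩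
  q *ˢ count (bump ∘ cells₂₁) 1 +ˢ q ^ˢ 2 *ˢ count (suc ∘ cells₂) 1
    ≈⟨ +-cong (≈-trans (*-congˡ {q} count-bump-1) (zeroʳ q))
         (*-congˡ {q ^ˢ 2} (count-suc∘ cells₂ 0)) ⟩
  0ˢ +ˢ q ^ˢ 2 *ˢ F 0
    ≈⟨ +-identityˡ (q ^ˢ 2 *ˢ F 0) ⟩
  q ^ˢ 2 *ˢ F 0 ∎

H-suc² : ∀ k → H (suc (suc k)) ≈ F (suc k)
H-suc² k = begin
  H (suc (suc k))
    ≈⟨ count-suc cells₂₁ (suc k) refl ⟩
  q *ˢ count (bump ∘ cells₂₁) (suc (suc k)) +ˢ q ^ˢ 2 *ˢ count (suc ∘ cells₂) (suc (suc k))
    ≈⟨ +-cong (*-congˡ {q} (count-bump-suc k)) (*-congˡ {q ^ˢ 2} (count-suc∘ cells₂ (suc k))) ⟩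
  q *ˢ H (suc k) +ˢ q ^ˢ 2 *ˢ F (suc k)
    ≈⟨ count-suc cells₂ k refl ⟨
  F (suc k) ∎

F-suc : ∀ k → 1-q² *ˢ F (suc k) ≈ q *ˢ H (suc k)
F-suc k = solve-linear (q ^ˢ 2) (q *ˢ H (suc k)) (F (suc k))
  (≈-trans (count-suc cells₂ k refl) (+-comm (q *ˢ H (suc k)) (q ^ˢ 2 *ˢ F (suc k))))

F-0-closed : 1-q *ˢ (1-q² *ˢ F 0) ≈ 1ˢ
F-0-closed = begin
  1-q *ˢ (1-q² *ˢ F 0)  ≈⟨ *-congˡ {1-q} (solve-linear (q ^ˢ 2) (H 0) (F 0) F-0) ⟩
  1-q *ˢ H 0            ≈⟨ solve-linear q 1ˢ (H 0) (≈-trans H-0 (+-comm 1ˢ (q *ˢ H 0))) ⟩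
  1ˢ                    ∎

-- One factor `1-q²` turns `F (suc k)` into `q *ˢ H (suc k)`. By `H-suc²`, `H-closed` then falls
-- back on `F-closed` at the preceding index, so the two inductions alternate down to `H 1`, where
-- `q ^ˢ 2 *ˢ F 0` takes over.
F-closed : ∀ k → 1-q *ˢ (1-q² ^ˢ (2 + k) *ˢ F (suc k)) ≈ q ^ˢ (3 + k)
F-closed k = ≈-trans (*-congˡ {1-q} (begin
  1-q² *ˢ 1-q² ^ˢ (1 + k) *ˢ F (suc k)    ≈⟨ xy∙z≈y∙xz 1-q² (1-q² ^ˢ (1 + k)) (F (suc k)) ⟩
  1-q² ^ˢ (1 + k) *ˢ (1-q² *ˢ F (suc k))  ≈⟨ *-congˡ {1-q² ^ˢ (1 + k)} (F-suc k) ⟩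
  1-q² ^ˢ (1 + k) *ˢ (q *ˢ H (suc k))     ≈⟨ x∙yz≈y∙xz (1-q² ^ˢ (1 + k)) q (H (suc k)) ⟩
  q *ˢ (1-q² ^ˢ (1 + k) *ˢ H (suc k))     ∎))
  (≈-trans (x∙yz≈y∙xz 1-q q (1-q² ^ˢ (1 + k) *ˢ H (suc k))) (*-congˡ {q} (H-closed k)))
  where
  H-closed : ∀ k → 1-q *ˢ (1-q² ^ˢ (1 + k) *ˢ H (suc k)) ≈ q ^ˢ (2 + k)
  H-closed zero = begin
    1-q *ˢ (1-q² *ˢ 1ˢ *ˢ H 1)        ≈⟨ *-congˡ {1-q} (*-cong (*-identityʳ 1-q²) H-1) ⟩
    1-q *ˢ (1-q² *ˢ (q ^ˢ 2 *ˢ F 0))  ≈⟨ *-congˡ {1-q} (x∙yz≈y∙xz 1-q² (q ^ˢ 2) (F 0)) ⟩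
    1-q *ˢ (q ^ˢ 2 *ˢ (1-q² *ˢ F 0))  ≈⟨ x∙yz≈y∙xz 1-q (q ^ˢ 2) (1-q² *ˢ F 0) ⟩
    q ^ˢ 2 *ˢ (1-q *ˢ (1-q² *ˢ F 0))  ≈⟨ *-congˡ {q ^ˢ 2} F-0-closed ⟩
    q ^ˢ 2 *ˢ 1ˢ                      ≈⟨ *-identityʳ (q ^ˢ 2) ⟩
    q ^ˢ 2                            ∎
  H-closed (suc k) = ≈-trans (*-congˡ {1-q} (*-congˡ {1-q² ^ˢ (2 + k)} (H-suc² k))) (F-closed k)

A-closed : ∀ k → 1-q ^ˢ 2 *ˢ 1-q² ^ˢ (2 + k) *ˢ A (suc k) ≈ q ^ˢ (5 + k)
A-closed k = begin
  1-q ^ˢ 2 *ˢ P *ˢ A (suc k)           ≈⟨ *-assoc (1-q ^ˢ 2) P (A (suc k)) ⟩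
  1-q *ˢ (1-q *ˢ 1ˢ) *ˢ (P *ˢ A (suc k))
    ≈⟨ *-congʳ {P *ˢ A (suc k)} (*-congˡ {1-q} (*-identityʳ 1-q)) ⟩
  1-q *ˢ 1-q *ˢ (P *ˢ A (suc k))       ≈⟨ *-assoc 1-q 1-q (P *ˢ A (suc k)) ⟩
  1-q *ˢ (1-q *ˢ (P *ˢ A (suc k)))     ≈⟨ *-congˡ {1-q} (x∙yz≈y∙xz 1-q P (A (suc k))) ⟩
  1-q *ˢ (P *ˢ (1-q *ˢ A (suc k)))
    -- One factor `1-q` absorbs the leading 1s, reducing `A` to `q ^ˢ 2 *ˢ F`; the other is left for
    -- `F-closed`.
    ≈⟨ *-congˡ {1-q} (*-congˡ {P} (solve-linear q (q ^ˢ 2 *ˢ F (suc k)) (A (suc k))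
         (count-suc cells k refl))) ⟩
  1-q *ˢ (P *ˢ (q ^ˢ 2 *ˢ F (suc k)))  ≈⟨ *-congˡ {1-q} (x∙yz≈y∙xz P (q ^ˢ 2) (F (suc k))) ⟩
  1-q *ˢ (q ^ˢ 2 *ˢ (P *ˢ F (suc k)))  ≈⟨ x∙yz≈y∙xz 1-q (q ^ˢ 2) (P *ˢ F (suc k)) ⟩
  q ^ˢ 2 *ˢ (1-q *ˢ (P *ˢ F (suc k)))  ≈⟨ *-congˡ {q ^ˢ 2} (F-closed k) ⟩
  q *ˢ (q *ˢ 1ˢ) *ˢ q ^ˢ (3 + k)
    ≈⟨ *-congʳ {q ^ˢ (3 + k)} (*-congˡ {q} (*-identityʳ q)) ⟩
  q *ˢ q *ˢ q ^ˢ (3 + k)               ≈⟨ *-assoc q q (q ^ˢ (3 + k)) ⟩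
  q ^ˢ (5 + k)                         ∎
  where P = 1-q² ^ˢ (2 + k)

theorem2p2 : (k : ℕ) → 1 ≤ k →
    (λ n → + w n k) ≈ q ^ˢ (k + 4) /ˢ ((1ˢ -ˢ q) ^ˢ 2 *ˢ (1ˢ -ˢ q ^ˢ 2) ^ˢ (k + 1))
theorem2p2 (suc k) _ = /ˢ-unique (q ^ˢ (suc k + 4)) denominator (λ n → + w n (suc k))
  (denominator-constant (suc k)) (begin
    denominator *ˢ (λ n → + w n (suc k))      ≈⟨ *-congˡ {denominator} (w-count (suc k)) ⟩
    denominator *ˢ A (suc k)
      -- `k + 1` is stuck on the variable `k`; commuting it exposes the successor that `A-closed`
      -- expects.
      ≡⟨ cong (λ m → 1-q ^ˢ 2 *ˢ 1-q² ^ˢ suc m *ˢ A (suc k)) (ℕ.+-comm k 1) ⟩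
    1-q ^ˢ 2 *ˢ 1-q² ^ˢ (2 + k) *ˢ A (suc k)  ≈⟨ A-closed k ⟩
    q ^ˢ (5 + k)                              ≡⟨ cong (λ m → q ^ˢ suc m) (ℕ.+-comm k 4) ⟨
    q ^ˢ (suc k + 4)                          ∎)
  where denominator = 1-q ^ˢ 2 *ˢ 1-q² ^ˢ (suc k + 1)
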